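{- For the cop and killer game there exists an infinite graph that is cop-win, there exists an infinite graph that is killer-win, and there exists an infinite graph that is stalemate.
   Context: Graphs are simple and undirected; an infinite graph is one with infinitely many vertices. The cop and killer game on a graph $G$ is the following perfect-information game. First the cop picks a starting vertex, then the killer picks a starting vertex different from the cop's. Then the players alternate turns, the cop moving first; on each turn the player must move to a vertex adjacent to her/his current vertex (staying put is not allowed; a player on a vertex with no neighbours simply remains there). If after a move of the cop she occupies the killer's vertex, the cop wins; if after a move of the killer he occupies the cop's vertex, the killer wins; if neither ever happens, the game is a stalemate. $G$ is cop-win if the cop has a strategy that guarantees she wins, killer-win if the killer has a strategy that guarantees he wins, and stalemate if neither is the case. -}

module Defs where

open import Data.List.NonEmpty using (List⁺; [_]; _∷⁺_; head)
open import Data.Nat using (ℕ)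
open import Data.Product using (_×_; _,_; ∃; ∃-syntax; proj₁; proj₂)
open import Data.Sum using (_⊎_)
open import Function.Bundles using (_↣_)
open import Level using (0ℓ)
open import Relation.Binary.Core using (Rel)
open import Relation.Binary.Definitions using (Symmetric; Irreflexive)
open import Relation.Binary.PropositionalEquality using (_≡_; _≢_)
open import Relation.Nullary using (¬_)

record Graph : Set₁ where
  infix 4 _~_
  field
    Vertex   : Set
    _~_      : Rel Vertex 0ℓ
    ~-sym    : Symmetric _~_
    ~-irrefl : Irreflexive _≡_ _~_

Infinite : Graph → Set
Infinite G = ℕ ↣ Graph.Vertex G

module Game (G : Graph) where
  open Graph G

  -- Staying put is legal only on a vertex without neighbours.
  Move : Vertex → Vertex → Set
  Move u v = (u ~ v) ⊎ ((∀ w → ¬ (u ~ w)) × v ≡ u)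

  record Position : Set where
    constructor ⟨_,_⟩
    field
      cop killer : Vertex
  open Position public

  -- The positions with the cop to move, from the current one (the head)
  -- back to the initial one.
  History : Set
  History = List⁺ Position

  record CopStrategy : Set where
    field
      start : Vertex
      move  : (h : History) → ∃ (Move (cop (head h)))

  -- The killer moves knowing the history and the vertex to which the cop
  -- has just moved.
  record KillerStrategy : Set where
    field
      start : (c : Vertex) → ∃[ k ] k ≢ c
      move  : (h : History) (c : Vertex) → ∃ (Move (killer (head h)))

  module _ (σ : CopStrategy) (τ : KillerStrategy) where

    initial : History
    initial = [ ⟨ c , proj₁ (KillerStrategy.start τ c) ⟩ ]
      where c = CopStrategy.start σ

    copTo : History → Vertex
    copTo h = proj₁ (CopStrategy.move σ h)

    killerTo : History → Vertex
    killerTo h = proj₁ (KillerStrategy.move τ h (copTo h))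

    next : History → History
    next h = ⟨ copTo h , killerTo h ⟩ ∷⁺ h

    -- The outcome of the play of σ against τ continued from a history.
    -- Being inductive, these require the capture to occur after finitely
    -- many rounds; the game ends at the first capture.
    data CopWinsFrom (h : History) : Set where
      capture : copTo h ≡ killer (head h) → CopWinsFrom h
      later   : copTo h ≢ killer (head h) → killerTo h ≢ copTo h →
                CopWinsFrom (next h) → CopWinsFrom h

    data KillerWinsFrom (h : History) : Set where
      capture : copTo h ≢ killer (head h) → killerTo h ≡ copTo h →
                KillerWinsFrom h
      later   : copTo h ≢ killer (head h) → killerTo h ≢ copTo h →
                KillerWinsFrom (next h) → KillerWinsFrom h

    CopWins : Set
    CopWins = CopWinsFrom initial

    KillerWins : Set
    KillerWins = KillerWinsFrom initial

CopWin : Graph → Set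
CopWin G = ∃[ σ ] ∀ τ → CopWins σ τ
  where open Game G

KillerWin : Graph → Set
KillerWin G = ∃[ τ ] ∀ σ → KillerWins σ τ
  where open Game G

Stalemate : Graph → Set
Stalemate G = ¬ CopWin G × ¬ KillerWin G

{-# OPTIONS --safe #-}

-- In the star, the cop starts at the centre and captures with her first move.
-- In the complete bipartite graph with two infinite sides, the killer starts
-- on the cop's side; her first move takes her to the other side, all of which
-- is adjacent to him. In the edgeless graph nobody ever moves.
module Submission where

open import Data.Bool using (Bool; true; not)
open import Data.Bool.Properties using (_≟_; not-¬)
open import Data.Empty using (⊥; ⊥-elim)
open import Data.List.NonEmpty using (head)
open import Data.Nat using (ℕ; zero; suc)
open import Data.Nat.Properties using (1+n≢n)
open import Data.Product using (_×_; _,_; ∃; ∃-syntax; proj₁; proj₂)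
open import Data.Product.Properties using (,-injectiveʳ)
open import Data.Sum using (inj₁; inj₂)
open import Function.Base using (_∘_)
open import Function.Bundles using (mk↣)
open import Function.Construct.Identity using (↣-id)
open import Relation.Binary.PropositionalEquality
  using (_≡_; _≢_; refl; sym; trans; cong; ≢-sym)
open import Relation.Nullary using (¬_; yes; no)

open import Defs

data StarEdge : ℕ → ℕ → Set where
  outward : ∀ {n} → StarEdge zero (suc n)
  inward  : ∀ {n} → StarEdge (suc n) zero

star : Graph
star = record
  { Vertex   = ℕ
  ; _~_      = StarEdge
  ; ~-sym    = λ { outward → inward ; inward → outward }
  ; ~-irrefl = λ { refl () }
  }

star-infinite : Infinite star
star-infinite = ↣-id ℕ

module _ where
  open Game star

  chase : (p : Position) → ∃ (Move (cop p))
  -- A filler value, where any leaf would do: the killer has to start off the centre.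
  chase ⟨ zero  , zero  ⟩ = 1 , inj₁ outward
  chase ⟨ zero  , suc k ⟩ = suc k , inj₁ outward
  chase ⟨ suc _ , _     ⟩ = zero , inj₁ inward

  chase-from-centre : ∀ {k} → k ≢ zero → proj₁ (chase ⟨ zero , k ⟩) ≡ k
  chase-from-centre {zero}  k≢0 = ⊥-elim (k≢0 refl)
  chase-from-centre {suc _} _   = refl

  star-copWin : CopWin star
  star-copWin =
    record { start = zero ; move = chase ∘ head } ,
    λ τ → capture (chase-from-centre (proj₂ (KillerStrategy.start τ zero)))

bipartite : Graph
bipartite = record
  { Vertex   = Bool × ℕ
  ; _~_      = λ u v → proj₁ u ≢ proj₁ v
  ; ~-sym    = ≢-sym
  ; ~-irrefl = λ { refl u≢u → u≢u refl }
  }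

bipartite-infinite : Infinite bipartite
bipartite-infinite = mk↣ {to = λ n → true , n} ,-injectiveʳ

module _ where
  open Game bipartite
  open Graph bipartite using (Vertex; _~_)

  opposite : (u : Vertex) → ∃ (u ~_)
  opposite (b , n) = (not b , n) , not-¬ refl

  -- No vertex is isolated, since `opposite` always supplies a neighbour. So the cop's first move
  -- has to change sides.
  move⇒~ : ∀ {u v} → Move u v → u ~ v
  move⇒~     (inj₁ u~v)            = u~v
  move⇒~ {u} (inj₂ (isolated , _)) =
    ⊥-elim (isolated (proj₁ (opposite u)) (proj₂ (opposite u)))

  strike : (k c : Vertex) → ∃ (Move k)
  strike k c with proj₁ k ≟ proj₁ c
  ... | no  k~c = c , inj₁ k~c
  -- A legal move for the case when the cop is out of reach. It never occurs in the first round,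
  -- where the play ends.
  ... | yes _   = proj₁ (opposite k) , inj₁ (proj₂ (opposite k))

  strike-neighbour : ∀ k c → k ~ c → proj₁ (strike k c) ≡ c
  strike-neighbour k c k~c with proj₁ k ≟ proj₁ c
  ... | no  _  = refl
  ... | yes eq = ⊥-elim (k~c eq)

  bipartite-killerWin : KillerWin bipartite
  bipartite-killerWin = τ , wins
    where
    τ : KillerStrategy
    τ = record
      -- Keeping `b` puts the killer on the cop's side, out of her reach; `suc n` makes the vertices
      -- differ.
      { start = λ (b , n) → (b , suc n) , 1+n≢n ∘ ,-injectiveʳ
      ; move  = λ h c → strike (killer (head h)) c
      }

    wins : ∀ σ → KillerWins σ τ
    wins σ =
      capture (λ c≡k → k~c (cong proj₁ (sym c≡k))) (strike-neighbour k c k~c)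
      where
      k = killer (head (initial σ τ))
      c = copTo σ τ (initial σ τ)

      k~c : k ~ c
      -- Adjacency compares only sides and the killer starts on the cop's side, so her edge to `c`
      -- is definitionally an edge from `k` to `c`.
      k~c = move⇒~ (proj₂ (CopStrategy.move σ (initial σ τ)))

edgeless : Graph
edgeless = record
  { Vertex   = ℕ
  ; _~_      = λ _ _ → ⊥
  ; ~-sym    = λ ()
  ; ~-irrefl = λ _ ()
  }

edgeless-infinite : Infinite edgeless
edgeless-infinite = ↣-id ℕ

module _ where
  open Game edgeless

  stay : ∀ u → Move u u
  stay u = inj₂ ((λ _ ()) , refl)

  move⇒≡ : ∀ {u v} → Move u v → v ≡ u
  move⇒≡ (inj₂ (_ , v≡u)) = v≡u

  module _ (σ : CopStrategy) (τ : KillerStrategy) where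

    Apart : History → Set
    Apart h = killer (head h) ≢ cop (head h)

    copTo≡cop : ∀ h → copTo σ τ h ≡ cop (head h)
    copTo≡cop h = move⇒≡ (proj₂ (CopStrategy.move σ h))

    killerTo≡killer : ∀ h → killerTo σ τ h ≡ killer (head h)
    killerTo≡killer h = move⇒≡ (proj₂ (KillerStrategy.move τ h (copTo σ τ h)))

    -- The cop stays put, so a capture would contradict `Apart h`. The induction is on the finite
    -- derivation of the win; `later` itself carries `Apart` for the next history.
    apart⇒¬copWinsFrom : ∀ {h} → Apart h → ¬ CopWinsFrom σ τ h
    apart⇒¬copWinsFrom {h} k≢c (capture eq) =
      k≢c (trans (sym eq) (copTo≡cop h))
    apart⇒¬copWinsFrom _ (later _ k≢c w) = apart⇒¬copWinsFrom k≢c w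

    apart⇒¬killerWinsFrom : ∀ {h} → Apart h → ¬ KillerWinsFrom σ τ h
    -- The killer stays put, so the cop would already have stepped onto his vertex, which `c≢k`
    -- excludes.
    apart⇒¬killerWinsFrom {h} _ (capture c≢k eq) =
      c≢k (trans (sym eq) (killerTo≡killer h))
    apart⇒¬killerWinsFrom _ (later _ k≢c w) = apart⇒¬killerWinsFrom k≢c w

    initial-apart : Apart (initial σ τ)
    initial-apart = proj₂ (KillerStrategy.start τ (CopStrategy.start σ))

  edgeless-stalemate : Stalemate edgeless
  edgeless-stalemate =
    -- A winning strategy must beat every opponent, so one arbitrary opponent, `τ₀` or `σ₀`, refutes
    -- it.
    (λ (σ , wins) → apart⇒¬copWinsFrom σ τ₀ (initial-apart σ τ₀) (wins τ₀)) ,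
    (λ (τ , wins) → apart⇒¬killerWinsFrom σ₀ τ (initial-apart σ₀ τ) (wins σ₀))
    where
    σ₀ : CopStrategy
    σ₀ = record { start = zero ; move = λ h → _ , stay (cop (head h)) }

    τ₀ : KillerStrategy
    τ₀ = record
      { start = λ c → suc c , 1+n≢n
      ; move  = λ h _ → _ , stay (killer (head h))
      }

lemma5 : (∃[ G ] (Infinite G × CopWin G)) ×
    (∃[ G ] (Infinite G × KillerWin G)) ×
    (∃[ G ] (Infinite G × Stalemate G))
lemma5 =
  (star , star-infinite , star-copWin) ,
  (bipartite , bipartite-infinite , bipartite-killerWin) ,
  (edgeless , edgeless-infinite , edgeless-stalemate)
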